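{- Let $r\ge 3$ and let $t$ be an integer with $1\le t\le r-2$. Then $\mathrm{cov}(r,r+t)\le t+1$.
   Context: A complete $r$-uniform $r$-partite hypergraph $K$ has a vertex set $V=V(K)$ partitioned into nonempty classes $V_1\cup\dots\cup V_r$, and its edges are exactly the sets containing one vertex from each class. A $k$-coloring of a hypergraph is an assignment of a color from $[k]=\{1,\dots,k\}$ to each edge (not all $k$ colors need be used). A coloring is spanning if every vertex is incident to edges of every color used in the coloring. For an edge-colored hypergraph $H$, let $H_i$ be the subhypergraph on vertex set $V(H)$ consisting of the edges of color $i$. A hypergraph is connected if it has only one vertex or any two distinct vertices can be connected by a sequence of edges each intersecting the next; every hypergraph is uniquely partitioned into connected components. A monochromatic component of $H$ is (the vertex set of) a connected component of $H_i$ for some color $i$. Let $c(H)$ be the minimum integer $m$ such that $V(H)$ can be covered by $m$ monochromatic components of $H$. $\mathrm{cov}(r,k)$ is the maximum of $c(K)$ when $K$ ranges over all spanning $k$-colorings of complete $r$-uniform $r$-partite hypergraphs. -}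

module Defs where

open import Data.Fin.Base using (Fin; zero; suc)
open import Data.Fin.Properties using (_≟_; any?; all?)
open import Data.Fin.Subset using (Subset; _∈_; _∩_; Nonempty)
open import Data.Fin.Subset.Properties using (_∈?_; anySubset?; x∈p∩q⁺; x∈p∩q⁻)
open import Data.List.Base using (List; []; _∷_; allFin)
open import Data.List.Membership.Propositional using () renaming (_∈_ to _∈ˡ_)
open import Data.List.Membership.Propositional.Properties using (∈-allFin)
open import Data.List.Relation.Unary.Any using (here; there)
open import Data.Nat.Base using (ℕ; zero; suc; _≤_; z≤n; s≤s)
open import Data.Nat.Properties using (≤-trans)
open import Data.Product using (_×_; _,_; proj₁; proj₂; ∃; ∃-syntax; Σ-syntax; ∃!)
open import Data.Sum.Base using (_⊎_; inj₁; inj₂)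
open import Data.Vec.Base using (Vec; []; _∷_; tabulate)
open import Data.Vec.Properties using (lookup∘tabulate; []=⇒lookup; lookup⇒[]=)
open import Data.Vec.Relation.Unary.All as All using (All)
import Data.Vec.Relation.Unary.All.Properties as All
open import Data.Vec.Relation.Unary.Any as Any using (Any)
import Data.Vec.Relation.Unary.Any.Properties as Any
open import Function.Base using (_∘_)
open import Function.Bundles using (_⇔_; mk⇔; Equivalence)
open import Level using (0ℓ)
open import Relation.Binary.Construct.Closure.ReflexiveTransitive using (Star; ε; _◅_; _◅◅_)
open import Relation.Binary.Core using (Rel)
import Relation.Binary.Definitions as B
open import Relation.Binary.PropositionalEquality using (_≡_; refl; sym; trans; cong)
open import Relation.Nullary using (Dec; yes; no; does; contradiction)
open import Relation.Nullary.Decidable using (map′; _×-dec_; _⊎-dec_; _→-dec_; dec-true)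
open import Relation.Unary using (Pred; Decidable)

------------------------------------------------------------------------
-- Hypergraphs and connected components

-- Decidability of `Edge` says that the edges form a genuine finite family
-- of vertex sets.
record Hypergraph : Set₁ where
  field
    order : ℕ
    Edge  : Pred (Subset order) 0ℓ
    edge? : Decidable Edge

module _ (H : Hypergraph) where
  open Hypergraph H

  -- Sequences of edges, each intersecting the next, with given first and
  -- last edge.
  data Chain : Rel (Subset order) 0ℓ where
    [_]    : ∀ {e} → Edge e → Chain e e
    _∷⟨_⟩_ : ∀ {e f g} → Edge e → Nonempty (e ∩ f) → Chain f g → Chain e g

  Linked : Rel (Fin order) 0ℓ
  Linked u v = u ≡ v ⊎ ∃[ e ] ∃[ f ] (u ∈ e × v ∈ f × Chain e f)

  -- The connected components are the classes of `Linked`; a vertex lying in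
  -- no edge is a component by itself.
  IsComponent : Pred (Subset order) 0ℓ
  IsComponent C = ∃[ u ] ∀ v → v ∈ C ⇔ Linked u v

------------------------------------------------------------------------
-- Colourings

-- The colour set [k] is Fin k.  The proof that e is an edge is irrelevant,
-- so the colour depends on the vertex set e only.
Coloring : Hypergraph → ℕ → Set
Coloring H k = ∀ e → .(Edge e) → Fin k
  where open Hypergraph H

module _ (H : Hypergraph) {k : ℕ} (χ : Coloring H k) where
  open Hypergraph H

  colorClass : Fin k → Hypergraph
  colorClass i = record
    { order = order
    ; Edge  = λ e → Σ[ p ∈ Edge e ] χ e p ≡ i
    ; edge? = colored?
    }
    where
    colored? : Decidable (λ e → Σ[ p ∈ Edge e ] χ e p ≡ i)
    colored? e with edge? e
    ... | no ¬p = no (¬p ∘ proj₁)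
    ... | yes p = map′ (p ,_) proj₂ (χ e p ≟ i)

  Used : Pred (Fin k) 0ℓ
  Used i = ∃ (Hypergraph.Edge (colorClass i))

  Spanning : Set
  Spanning = ∀ i → Used i → ∀ v → ∃[ e ] (Hypergraph.Edge (colorClass i) e × v ∈ e)

  IsMonochromaticComponent : Pred (Subset order) 0ℓ
  IsMonochromaticComponent C = ∃[ i ] IsComponent (colorClass i) C

  CoverableBy : Pred ℕ 0ℓ
  CoverableBy m = Σ[ Cs ∈ Vec (Subset order) m ]
    (All IsMonochromaticComponent Cs × ∀ v → Any (v ∈_) Cs)

IsMinimum : Pred ℕ 0ℓ → Pred ℕ 0ℓ
IsMinimum P m = P m × (∀ m′ → P m′ → m ≤ m′)

IsMaximum : Pred ℕ 0ℓ → Pred ℕ 0ℓ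
IsMaximum P m = P m × (∀ m′ → P m′ → m′ ≤ m)

IsCoverNumber : (H : Hypergraph) {k : ℕ} → Coloring H k → Pred ℕ 0ℓ
IsCoverNumber H χ = IsMinimum (CoverableBy H χ)

------------------------------------------------------------------------
-- Complete r-uniform r-partite hypergraphs

record Partition (r : ℕ) : Set where
  field
    order    : ℕ
    class    : Fin order → Fin r
    nonempty : ∀ i → ∃[ v ] class v ≡ i

Transversal : ∀ {r} (V : Partition r) → Pred (Subset (Partition.order V)) 0ℓ
Transversal V e = ∀ i → ∃! _≡_ λ v → v ∈ e × class v ≡ i
  where open Partition V

transversal? : ∀ {r} (V : Partition r) → Decidable (Transversal V)
transversal? V e = all? λ i → any? λ v → member? i v ×-dec
  map′ (λ f {w} → f w) (λ f w → f {w}) (all? λ w → member? i w →-dec v ≟ w)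
  where
  open Partition V
  member? : ∀ i v → Dec (v ∈ e × class v ≡ i)
  member? i v = (v ∈? e) ×-dec (class v ≟ i)

complete : ∀ {r} → Partition r → Hypergraph
complete V = record
  { order = Partition.order V
  ; Edge  = Transversal V
  ; edge? = transversal? V
  }

------------------------------------------------------------------------
-- Existence of the minimum defining c

private
  least : ∀ {P : Pred ℕ 0ℓ} → Decidable P → ∀ b → P b → ∃ (IsMinimum P)
  least P? b p with P? 0
  least P? b       p | yes p₀ = 0 , p₀ , λ _ _ → z≤n
  least P? zero    p | no ¬p₀ = contradiction p ¬p₀
  least P? (suc b) p | no ¬p₀ with least (P? ∘ suc) b p
  ... | m , pm , min = suc m , pm , λ where
    zero     p₀ → contradiction p₀ ¬p₀
    (suc m′) p′ → s≤s (min m′ p′)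

  anyVec? : ∀ {n} m {P : Pred (Vec (Subset n) m) 0ℓ} → Decidable P → Dec (∃ P)
  anyVec? zero    P? = map′ ([] ,_) (λ { ([] , p) → p }) (P? [])
  anyVec? (suc m) P? =
    map′ (λ { (x , xs , p) → x ∷ xs , p }) (λ { (x ∷ xs , p) → x , xs , p })
         (anySubset? λ x → anyVec? m λ xs → P? (x ∷ xs))

  _⇔?_ : ∀ {A B : Set} → Dec A → Dec B → Dec (A ⇔ B)
  a? ⇔? b? = map′ (λ (f , g) → mk⇔ f g) (λ e → Equivalence.to e , Equivalence.from e)
                  ((a? →-dec b?) ×-dec (b? →-dec a?))

  comprehension : ∀ {n} {P : Pred (Fin n) 0ℓ} → Decidable P → Subset n
  comprehension P? = tabulate (does ∘ P?)

  ∈-comprehension : ∀ {n} {P : Pred (Fin n) 0ℓ} (P? : Decidable P) →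
                    ∀ v → v ∈ comprehension P? ⇔ P v
  ∈-comprehension {P = P} P? v = mk⇔ to from
    where
    to : v ∈ comprehension P? → P v
    to v∈ with P? v | trans (sym (lookup∘tabulate (does ∘ P?) v)) ([]=⇒lookup v∈)
    ... | yes p | _ = p
    from : P v → v ∈ comprehension P?
    from p = lookup⇒[]= v _ (trans (lookup∘tabulate (does ∘ P?) v) (dec-true (P? v) p))

  -- Warshall's algorithm: `Via xs` allows the vertices of xs as intermediate
  -- stops.
  module Reachability {n} {R : Rel (Fin n) 0ℓ} (R? : B.Decidable R) where

    Via : List (Fin n) → Rel (Fin n) 0ℓ
    Via []       u v = u ≡ v ⊎ R u v
    Via (x ∷ xs) u v = Via xs u v ⊎ (Via xs u x × Via xs x v)

    via? : ∀ xs → B.Decidable (Via xs)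
    via? []       u v = (u ≟ v) ⊎-dec R? u v
    via? (x ∷ xs) u v = via? xs u v ⊎-dec (via? xs u x ×-dec via? xs x v)

    via⇒star : ∀ xs {u v} → Via xs u v → Star R u v
    via⇒star []       (inj₁ refl)    = ε
    via⇒star []       (inj₂ r)       = r ◅ ε
    via⇒star (x ∷ xs) (inj₁ p)       = via⇒star xs p
    via⇒star (x ∷ xs) (inj₂ (p , q)) = via⇒star xs p ◅◅ via⇒star xs q

    via-base : ∀ xs {u v} → Via [] u v → Via xs u v
    via-base []       p = p
    via-base (x ∷ xs) p = inj₁ (via-base xs p)

    via-trans : ∀ xs {u w v} → w ∈ˡ xs → Via xs u w → Via xs w v → Via xs u v
    via-trans (x ∷ xs) (here refl) p q = inj₂ (into p , out q)
      where
      into : ∀ {u} → Via (x ∷ xs) u x → Via xs u x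
      into (inj₁ p)       = p
      into (inj₂ (p , _)) = p
      out : ∀ {v} → Via (x ∷ xs) x v → Via xs x v
      out (inj₁ q)       = q
      out (inj₂ (_ , q)) = q
    via-trans (x ∷ xs) (there w∈) (inj₁ p)       (inj₁ q)       = inj₁ (via-trans xs w∈ p q)
    via-trans (x ∷ xs) (there w∈) (inj₁ p)       (inj₂ (q , s)) = inj₂ (via-trans xs w∈ p q , s)
    via-trans (x ∷ xs) (there w∈) (inj₂ (p , s)) (inj₁ q)       = inj₂ (p , via-trans xs w∈ s q)
    via-trans (x ∷ xs) (there w∈) (inj₂ (p , _)) (inj₂ (_ , s)) = inj₂ (p , s)

    star⇒via : ∀ {u v} → Star R u v → Via (allFin n) u v
    star⇒via ε        = via-base (allFin n) (inj₁ refl)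
    star⇒via (r ◅ rs) = via-trans (allFin n) (∈-allFin _)
      (via-base (allFin n) (inj₂ r)) (star⇒via rs)

    star? : B.Decidable (Star R)
    star? u v = map′ (via⇒star (allFin n)) star⇒via (via? (allFin n) u v)

module _ (H : Hypergraph) where
  open Hypergraph H

  private
    Adjacent : Rel (Fin order) 0ℓ
    Adjacent u v = ∃[ e ] (Edge e × u ∈ e × v ∈ e)

    adjacent? : B.Decidable Adjacent
    adjacent? u v = anySubset? λ e → edge? e ×-dec ((u ∈? e) ×-dec (v ∈? e))

    chain⇒star : ∀ {e f u v} → u ∈ e → v ∈ f → Chain H e f → Star Adjacent u v
    chain⇒star u∈e v∈f [ p ] = (_ , p , u∈e , v∈f) ◅ ε
    chain⇒star {e} u∈e v∈g (_∷⟨_⟩_ {f = f} p (w , w∈) c) =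
      (e , p , u∈e , proj₁ (x∈p∩q⁻ e f w∈)) ◅ chain⇒star (proj₂ (x∈p∩q⁻ e f w∈)) v∈g c

    linked⇒star : ∀ {u v} → Linked H u v → Star Adjacent u v
    linked⇒star (inj₁ refl)                     = ε
    linked⇒star (inj₂ (_ , _ , u∈e , v∈f , c)) = chain⇒star u∈e v∈f c

    star⇒linked : ∀ {u v} → Star Adjacent u v → Linked H u v
    star⇒linked ε = inj₁ refl
    star⇒linked ((e , p , u∈e , w∈e) ◅ s) with star⇒linked s
    ... | inj₁ refl                    = inj₂ (e , e , u∈e , w∈e , [ p ])
    ... | inj₂ (_ , f , w∈e′ , v∈f , c) =
      inj₂ (e , f , u∈e , v∈f , p ∷⟨ _ , x∈p∩q⁺ (w∈e , w∈e′) ⟩ c)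

  linked? : B.Decidable (Linked H)
  linked? u v = map′ star⇒linked linked⇒star (Reachability.star? adjacent? u v)

  isComponent? : Decidable (IsComponent H)
  isComponent? C = any? λ u → all? λ v → (v ∈? C) ⇔? linked? u v

  component : Fin order → Subset order
  component u = comprehension (linked? u)

  component-isComponent : ∀ u → IsComponent H (component u)
  component-isComponent u = u , ∈-comprehension (linked? u)

  self∈component : ∀ u → u ∈ component u
  self∈component u = Equivalence.from (∈-comprehension (linked? u) u) (inj₁ refl)

module _ (H : Hypergraph) {k : ℕ} (χ : Coloring H k) where
  open Hypergraph H

  coverableBy? : Decidable (CoverableBy H χ)
  coverableBy? m = anyVec? m λ Cs →
    All.all? (λ C → any? λ i → isComponent? (colorClass H χ i) C) Cs ×-dec
    all? (λ v → Any.any? (v ∈?_) Cs)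

  coverNumber : Fin k → ∃ (IsCoverNumber H χ)
  coverNumber i = least coverableBy? order
    ( tabulate (component Hᵢ)
    , All.tabulate⁺ (λ u → i , component-isComponent Hᵢ u)
    , λ v → Any.tabulate⁺ v (self∈component Hᵢ v)
    )
    where
    Hᵢ : Hypergraph
    Hᵢ = colorClass H χ i

complete-edge : ∀ {r} (V : Partition r) → ∃ (Transversal V)
complete-edge V = e , λ i → rep i
  , ( Equivalence.from (e-spec (rep i)) (cong rep (sym (rep-class i)))
    , rep-class i )
  , λ {w} (w∈e , w∈i) → sym (trans (Equivalence.to (e-spec w) w∈e) (cong rep w∈i))
  where
  open Partition V
  rep : Fin _ → Fin order
  rep i = proj₁ (nonempty i)
  rep-class : ∀ i → class (rep i) ≡ i
  rep-class i = proj₂ (nonempty i)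
  isRep? : Decidable (λ v → v ≡ rep (class v))
  isRep? v = v ≟ rep (class v)
  e : Subset order
  e = comprehension isRep?
  e-spec : ∀ v → v ∈ e ⇔ v ≡ rep (class v)
  e-spec = ∈-comprehension isRep?

------------------------------------------------------------------------
-- c and cov

module _ {r k : ℕ} (V : Partition r) (χ : Coloring (complete V) k) where

  private
    minimum : ∃ (IsCoverNumber (complete V) χ)
    minimum = coverNumber (complete V) χ
      (χ (proj₁ (complete-edge V)) (proj₂ (complete-edge V)))

  c : ℕ
  c = proj₁ minimum

  c-isCoverNumber : IsCoverNumber (complete V) χ c
  c-isCoverNumber = proj₂ minimum

CovValue : (r k : ℕ) → Pred ℕ 0ℓ
CovValue r k m = Σ[ V ∈ Partition r ] Σ[ χ ∈ Coloring (complete V) k ]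
  (Spanning (complete V) χ × c V χ ≡ m)

IsCov : (r k : ℕ) → Pred ℕ 0ℓ
IsCov r k = IsMaximum (CovValue r k)

-- The maximum cov(r,k) ranges over infinitely many hypergraphs, so it cannot
-- be computed by search.  The inequality cov(r,k) ≤ b is therefore expressed
-- as: b bounds every value over which the maximum is taken.
cov[_,_]≤_ : ℕ → ℕ → ℕ → Set
cov[ r , k ]≤ b = ∀ m → CovValue r k m → m ≤ b

cov≤⇔ : ∀ {r k b m} → IsCov r k m → cov[ r , k ]≤ b ⇔ m ≤ b
cov≤⇔ (val , max) = mk⇔ (λ bound → bound _ val) (λ m≤b m′ v → ≤-trans (max m′ v) m≤b)

{-# OPTIONS --safe #-}
module Submission where

open import Defs
open import Data.Nat.Base using (ℕ; _+_; _∸_; _≤_)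
open import Data.Empty using () renaming (⊥ to Empty)
open import Data.Fin.Base using (Fin; zero; suc)
open import Data.Fin.Properties using (_≟_; any?; injective⇒≤; ¬∀⟶∃¬)
open import Data.Fin.Subset
  using (Subset; inside; outside; _∈_; _∉_; _⊆_; _⊂_; _-_; _∩_; ∣_∣; ∁; ⊥; Nonempty)
open import Data.Fin.Subset.Properties
  using ( _∈?_; anySubset?; nonempty?; Empty-unique; x∈p∩q⁺; x∈p∩q⁻; ∉⊥; ⊥⊆; s⊆s; x∈⁅x⁆
        ; x∈p∧x≢y⇒x∈p-y; x∈p⇒∣p-x∣<∣p∣; p⊆q⇒∣p∣≤∣q∣; p⊂q⇒∣p∣<∣q∣
        ; x∉p⇒x∈∁p; x∈∁p⇒x∉p; ∣∁p∣≡n∸∣p∣; ∣⁅x⁆∣≡1; ∣⊥∣≡0; ∣p∣≤n )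
open import Data.List.Base using (List; []; _∷_; length; lookup)
open import Data.List.Membership.Propositional using (find) renaming (_∈_ to _∈ˡ_)
open import Data.List.Relation.Unary.All as All using (All; []; _∷_)
open import Data.List.Relation.Unary.Any as Any using (here; there; index)
open import Data.List.Relation.Unary.Any.Properties using (lookup-index)
open import Data.Nat.Base using (zero; suc; z≤n; s≤s; s≤s⁻¹; _<_)
open import Data.Nat.Properties as ℕ using (module ≤-Reasoning)
open import Data.Nat.Tactic.RingSolver using (solve-∀)
open import Data.Product.Base using (_×_; _,_; proj₁; proj₂; swap; ∃; ∃-syntax)
open import Data.Sum.Base using (inj₁; inj₂)
open import Data.Vec.Base as Vec using (Vec; []; _∷_; tabulate)
open import Data.Vec.Membership.Propositional using () renaming (_∈_ to _∈ᵛ_)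
open import Data.Vec.Membership.Propositional.Properties using (∈-map⁺)
open import Data.Vec.Properties using (lookup∘tabulate; []=⇒lookup; lookup⇒[]=)
import Data.Vec.Relation.Unary.All as VAll
import Data.Vec.Relation.Unary.All.Properties as VAll
import Data.Vec.Relation.Unary.Any as VAny
import Data.Vec.Relation.Unary.Any.Properties as VAny
open import Function.Base using (_∘_)
open import Function.Bundles using (Equivalence)
open import Level using (0ℓ)
open import Relation.Binary.PropositionalEquality
  using (_≡_; _≢_; refl; sym; trans; cong; subst)
open import Relation.Binary.Structures using (IsEquivalence; IsDecEquivalence)
open import Relation.Nullary using (yes; no; does; ¬_; contradiction)
open import Relation.Nullary.Decidable using (decidable-stable; dec-true; ¬?; _×-dec_)
open import Relation.Unary using (Pred; Decidable)

-- Suppose that no t + 1 monochromatic components cover the vertices, and call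
-- a colour separated by a set of vertices if they do not all lie in one
-- component of that colour.  As every component meets every class, a partial
-- transversal S grows into a transversal separating one more colour per added
-- vertex; a transversal cannot separate all colours, so the set A of colours
-- not separated by S satisfies |A| + |S| > r.
--
-- Let D be the largest number of colours separating two vertices of different
-- classes.  Start with such a pair, and enlarge it by vertices separating at
-- least two new colours each, until this is impossible.  Counting gives
-- D ≤ t + 1, D ≤ |A| and |S| < r.  Choose T ⊆ A with |T| = D, and a vertex w
-- outside the components of S in the colours of T.  By maximality of S, w lies
-- in the class of some a ∈ S; by maximality of D, it differs from the rest of
-- S exactly in T.  A vertex y of a class missed by S that differs from S and
-- from w in a colour i₁ ∈ T agrees with S on A ∖ {i₁}, hence differs from w
-- exactly in T, and so agrees with S ∖ {a} outside A.  Thus a differs from y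
-- outside A and in i₁: in more than D colours.

-- Counting in finite subsets.

private
  variable
    n : ℕ
    p q : Subset n
    x y : Fin n

comprehension : {P : Pred (Fin n) 0ℓ} → Decidable P → Subset n
comprehension P? = tabulate (does ∘ P?)

module _ {P : Pred (Fin n) 0ℓ} (P? : Decidable P) where

  ∈-comprehension⁺ : P x → x ∈ comprehension P?
  ∈-comprehension⁺ {x} px =
    lookup⇒[]= x _ (trans (lookup∘tabulate (does ∘ P?) x) (dec-true (P? x) px))

  ∈-comprehension⁻ : x ∈ comprehension P? → P x
  ∈-comprehension⁻ {x} x∈ with P? x | trans (sym (lookup∘tabulate (does ∘ P?) x)) ([]=⇒lookup x∈)
  ... | yes px | _ = px

elements : (p : Subset n) → Vec (Fin n) ∣ p ∣
elements []            = []
elements (inside  ∷ p) = zero ∷ Vec.map suc (elements p)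
elements (outside ∷ p) = Vec.map suc (elements p)

∈-elements : x ∈ p → x ∈ᵛ elements p
∈-elements {p = inside  ∷ _} Vec.here        = VAny.here refl
∈-elements {p = inside  ∷ _} (Vec.there x∈p) = VAny.there (∈-map⁺ suc (∈-elements x∈p))
∈-elements {p = outside ∷ _} (Vec.there x∈p) = ∈-map⁺ suc (∈-elements x∈p)

subset-of-size : ∀ d {p : Subset n} → d ≤ ∣ p ∣ → ∃[ q ] (q ⊆ p × ∣ q ∣ ≡ d)
subset-of-size {n} zero          _   = ⊥ , ⊥⊆ , ∣⊥∣≡0 n
subset-of-size (suc d) {inside  ∷ p} d≤p with subset-of-size d (s≤s⁻¹ d≤p)
... | q , q⊆p , eq = inside ∷ q , s⊆s q⊆p , cong suc eq
subset-of-size (suc d) {outside ∷ p} d≤p with subset-of-size (suc d) d≤p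
... | q , q⊆p , eq = outside ∷ q , s⊆s q⊆p , eq

-- Deleting `x` from `q` leaves a set that still contains `p`, and strictly so because of `y`.
two-more : p ⊆ q → x ∈ q → y ∈ q → x ∉ p → y ∉ p → x ≢ y → 2 + ∣ p ∣ ≤ ∣ q ∣
two-more {p = p} {q = q} {x = x} {y = y} p⊆q x∈q y∈q x∉p y∉p x≢y =
  ℕ.≤-trans (s≤s (p⊂q⇒∣p∣<∣q∣ p⊂q-x)) (x∈p⇒∣p-x∣<∣p∣ x∈q)
  where
  p⊂q-x : p ⊂ (q - x)
  p⊂q-x = (λ z∈p → x∈p∧x≢y⇒x∈p-y (p⊆q z∈p) λ { refl → x∉p z∈p })
        , y , x∈p∧x≢y⇒x∈p-y y∈q (x≢y ∘ sym) , y∉p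

two≤ : x ∈ p → y ∈ p → x ≢ y → 2 ≤ ∣ p ∣
two≤ {n} {p = p} x∈p y∈p x≢y =
  subst (λ m → 2 + m ≤ ∣ p ∣) (∣⊥∣≡0 n) (two-more ⊥⊆ x∈p y∈p ∉⊥ ∉⊥ x≢y)

another : ∀ (x : Fin n) → 2 ≤ ∣ p ∣ → ∃[ y ] (y ∈ p × x ≢ y)
another {p = p} x 2≤p with any? (λ y → (y ∈? p) ×-dec ¬? (x ≟ y))
... | yes found = found
... | no none   = contradiction (ℕ.≤-trans 2≤p ∣p∣≤1) λ { (s≤s ()) }
  where
  ∣p∣≤1 : ∣ p ∣ ≤ 1
  ∣p∣≤1 = subst (∣ p ∣ ≤_) (∣⁅x⁆∣≡1 x) (p⊆q⇒∣p∣≤∣q∣ λ {y} y∈p →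
    subst (_∈ _) (decidable-stable (x ≟ y) λ x≢y → none (y , y∈p , x≢y)) (x∈⁅x⁆ x))

element : 1 ≤ ∣ p ∣ → Nonempty p
element {n} {p} 1≤p with nonempty? p
... | yes found = found
... | no none   = contradiction
  (subst (1 ≤_) (trans (cong ∣_∣ (Empty-unique none)) (∣⊥∣≡0 n)) 1≤p) λ ()

-- Colours as equivalence relations, assuming no cover by `t + 1` components.

module _ {r k t : ℕ} (V : Partition r)
  (_∼[_]_ : Fin (Partition.order V) → Fin k → Fin (Partition.order V) → Set)
  (∼-isDecEquivalence : ∀ i → IsDecEquivalence (_∼[ i ]_))
  (1≤t : 1 ≤ t) (t+2≤r : 2 + t ≤ r) (k≤r+t : k ≤ r + t)
  (meets : ∀ i v c → ∃[ u ] (Partition.class V u ≡ c × v ∼[ i ] u))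
  (monochromatic : (f : Fin r → Fin (Partition.order V)) →
                   (∀ c → Partition.class V (f c) ≡ c) → ∃[ i ] ∀ c c′ → f c ∼[ i ] f c′)
  (uncovered : ∀ {m} → m ≤ suc t → (ps : Vec (Fin k × Fin (Partition.order V)) m) →
               ∃[ w ] ∀ {i v} → (i , v) ∈ᵛ ps → ¬ v ∼[ i ] w)
  where
  open Partition V

  private
    module ∼ {i} = IsDecEquivalence (∼-isDecEquivalence i)

    variable
      S : List (Fin order)
      u v w : Fin order
      i j : Fin k

  stable : ¬ ¬ u ∼[ i ] v → u ∼[ i ] v
  stable {u} {i} {v} = decidable-stable (∼-isDecEquivalence i .IsDecEquivalence._≟_ u v)

  Different : Fin order → Fin order → Pred (Fin k) 0ℓ
  Different u v i = ¬ u ∼[ i ] v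

  different? : ∀ u v → Decidable (Different u v)
  different? u v i = ¬? (u ∼.≟ v)

  different : Fin order → Fin order → Subset k
  different u v = comprehension (different? u v)

  Agree : List (Fin order) → Pred (Fin k) 0ℓ
  Agree S i = All (λ u → All (λ v → u ∼[ i ] v) S) S

  agree? : ∀ S → Decidable (Agree S)
  agree? S i = All.all? (λ u → All.all? (λ v → u ∼.≟ v) S) S

  opaque
    agree : List (Fin order) → Subset k
    agree S = comprehension (agree? S)

    agree⁺ : (∀ {u v} → u ∈ˡ S → v ∈ˡ S → u ∼[ i ] v) → i ∈ agree S
    agree⁺ {S} f = ∈-comprehension⁺ (agree? S) (All.tabulate λ u∈ → All.tabulate λ v∈ → f u∈ v∈)

    agree⁻ : i ∈ agree S → u ∈ˡ S → v ∈ˡ S → u ∼[ i ] v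
    agree⁻ {S = S} i∈ u∈ v∈ = All.lookup (All.lookup (∈-comprehension⁻ (agree? S) i∈) u∈) v∈

  agree-from : (∀ {v} → v ∈ˡ S → v ∼[ i ] w) → i ∈ agree S
  agree-from f = agree⁺ λ u∈ v∈ → ∼.trans (f u∈) (∼.sym (f v∈))

  agree-∷⊆ : agree (w ∷ S) ⊆ agree S
  agree-∷⊆ i∈ = agree⁺ λ u∈ v∈ → agree⁻ i∈ (there u∈) (there v∈)

  separated : u ∈ˡ S → ¬ u ∼[ i ] w → i ∉ agree (w ∷ S)
  separated u∈S u≁w i∈ = u≁w (agree⁻ i∈ (there u∈S) (here refl))

  PartialTransversal : List (Fin order) → Set
  PartialTransversal S = ∀ {u v} → u ∈ˡ S → v ∈ˡ S → class u ≡ class v → u ≡ v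

  Fresh : List (Fin order) → Pred (Fin order) 0ℓ
  Fresh S w = All (λ u → class u ≢ class w) S

  fresh? : ∀ S → Decidable (Fresh S)
  fresh? S w = All.all? (λ u → ¬? (class u ≟ class w)) S

  extend : PartialTransversal S → Fresh S w → PartialTransversal (w ∷ S)
  extend pt fr (here refl) (here refl) eq = refl
  extend pt fr (here refl) (there v∈) eq = contradiction (sym eq) (All.lookup fr v∈)
  extend pt fr (there u∈) (here refl) eq = contradiction eq (All.lookup fr u∈)
  extend pt fr (there u∈) (there v∈) eq = pt u∈ v∈ eq

  -- Pigeonhole: if `S` met every class, sending a class to the position of a vertex hitting it
  -- would inject `Fin r` into the positions of `S`.
  missing-class : length S < r → ∃[ c ] All (λ u → class u ≢ c) S
  missing-class {S} ∣S∣<r with any? (λ c → All.all? (λ u → ¬? (class u ≟ c)) S)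
  ... | yes found = found
  ... | no none = contradiction (injective⇒≤ index-injective) (ℕ.<⇒≱ ∣S∣<r)
    where
    hit : ∀ c → Any.Any (λ u → class u ≡ c) S
    hit c with Any.any? (λ u → class u ≟ c) S
    ... | yes p = p
    ... | no ¬p = contradiction
      (c , All.tabulate λ u∈ eq → ¬p (Any.map (λ { refl → eq }) u∈)) none
    index-injective : ∀ {c c′} → index (hit c) ≡ index (hit c′) → c ≡ c′
    index-injective {c} {c′} eq = trans (sym (lookup-index (hit c)))
      (trans (cong (class ∘ lookup S) eq) (lookup-index (hit c′)))

  -- Since `2 ≤ t + 1`, two components of one colour miss some `x`. The whole component of `x` is
  -- then disjoint from both, and it meets class `c`.
  avoid : ∀ i u v c → ∃[ w ] (class w ≡ c × ¬ u ∼[ i ] w × ¬ v ∼[ i ] w)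
  avoid i u v c with uncovered (s≤s 1≤t) ((i , u) ∷ (i , v) ∷ [])
  ... | x , x∉ with meets i x c
  ...   | w , w∈c , x∼w = w , w∈c
        , (λ u∼w → x∉ (VAny.here refl) (∼.trans u∼w (∼.sym x∼w)))
        , (λ v∼w → x∉ (VAny.there (VAny.here refl)) (∼.trans v∼w (∼.sym x∼w)))

  -- Arbitrary vertices in the classes missed by `S` complete it to a full transversal, which some
  -- colour does not separate.
  agree-nonempty : PartialTransversal S → Nonempty (agree S)
  agree-nonempty {S} pt = i₀ , agree⁺ λ u∈ v∈ →
      subst (_∼[ i₀ ] _) (f-class u∈) (subst (_ ∼[ i₀ ]_) (f-class v∈) (f-mono _ _))
    where
    pick : ∀ c → ∃[ u ] (class u ≡ c × ∀ {v} → v ∈ˡ S → class v ≡ c → u ≡ v)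
    pick c with Any.any? (λ u → class u ≟ c) S
    ... | yes p = let u , u∈ , eq = find p in u , eq , λ v∈ eq′ → pt u∈ v∈ (trans eq (sym eq′))
    ... | no ¬p = proj₁ (nonempty c) , proj₂ (nonempty c)
                , λ v∈ eq → contradiction (Any.map (λ { refl → eq }) v∈) ¬p
    f : Fin r → Fin order
    f = proj₁ ∘ pick
    f-class : v ∈ˡ S → f (class v) ≡ v
    f-class v∈ = proj₂ (proj₂ (pick _)) v∈ refl
    i₀ = proj₁ (monochromatic f (proj₁ ∘ proj₂ ∘ pick))
    f-mono = proj₂ (monochromatic f (proj₁ ∘ proj₂ ∘ pick))

  r≮agree : u ∈ˡ S → PartialTransversal S → r < ∣ agree S ∣ + length S
  r≮agree u∈ pt = ℕ.≰⇒> (go _ u∈ pt ℕ.≤-refl)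
    where
    -- `d` bounds the number of colours not yet separated. Each new vertex separates one of them
    -- from `u`; if `d + length S ≤ r`, there are classes enough to leave none, against
    -- `agree-nonempty`.
    go : ∀ d → u ∈ˡ S → PartialTransversal S → ∣ agree S ∣ ≤ d → ¬ d + length S ≤ r
    go {S = S} zero u∈ pt ∣A∣≤0 _ = contradiction
      (ℕ.<-≤-trans (x∈p⇒∣p-x∣<∣p∣ (proj₂ (agree-nonempty {S} pt))) ∣A∣≤0) λ ()
    go {u} {S} (suc d) u∈ pt ∣A∣≤ d+s≤r
      with agree-nonempty {S} pt | missing-class {S} (ℕ.≤-trans (s≤s (ℕ.m≤n+m _ d)) d+s≤r)
    ... | i , i∈A | c , c-fresh with avoid i u u c
    ...   | w , refl , u≁w , _ = go d (there u∈) (extend pt c-fresh)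
            (s≤s⁻¹ (ℕ.≤-trans (p⊂q⇒∣p∣<∣q∣ (agree-∷⊆ , i , i∈A , separated u∈ u≁w)) ∣A∣≤))
            (subst (_≤ r) (sym (ℕ.+-suc d (length S))) d+s≤r)

  -- Pairwise distances and maximal partial transversals.

  DistanceBound : ℕ → Set
  DistanceBound D = ∀ {u v} → class u ≢ class v → ∣ different u v ∣ ≤ D

  Extension : List (Fin order) → Pred (Fin order) 0ℓ
  Extension S w = Fresh S w × 2 + ∣ agree (w ∷ S) ∣ ≤ ∣ agree S ∣

  extension? : ∀ S → Decidable (Extension S)
  extension? S w = fresh? S w ×-dec (2 + ∣ agree (w ∷ S) ∣ ℕ.≤? ∣ agree S ∣)

  -- Differing from `u` in both `i` and `j` would remove two colours from `agree S` and make `w` an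
  -- extension.
  separates-one : ¬ ∃ (Extension S) → u ∈ˡ S → Fresh S w →
                  i ∈ agree S → j ∈ agree S → i ≢ j → ¬ u ∼[ i ] w → u ∼[ j ] w
  separates-one maximal u∈ fr i∈ j∈ i≢j u≁w = stable λ u≁w′ → maximal
    (_ , fr , two-more agree-∷⊆ i∈ j∈ (separated u∈ u≁w) (separated u∈ u≁w′) i≢j)

  module _ {D} (2≤D : 2 ≤ D) (bound : DistanceBound D) where

    module _ {u S} (u∈S : u ∈ˡ S) (pt : PartialTransversal S) (maximal : ¬ ∃ (Extension S))
      (D≤1+t : D ≤ suc t) (∣S∣<r : length S < r)
      (D≤∣A∣ : D ≤ ∣ agree S ∣) (D≤∣∁A∣ : D ≤ ∣ ∁ (agree S) ∣) where

      module _ {T} (T⊆A : T ⊆ agree S) (∣T∣≡D : ∣ T ∣ ≡ D) where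

        -- The `D` colours of `T` already exhaust what `bound` allows.
        agree-off : class v ≢ class w → (∀ {i} → i ∈ T → ¬ v ∼[ i ] w) → j ∉ T → v ∼[ j ] w
        agree-off {v} {w} v≢w v≁w j∉T = stable λ v≁ⱼw →
          ℕ.<⇒≱ (p⊂q⇒∣p∣<∣q∣ {q = different v w}
                   ( (λ i∈T → ∈-comprehension⁺ (different? v w) (v≁w i∈T))
                   , _ , ∈-comprehension⁺ (different? v w) v≁ⱼw , j∉T ))
                (subst (_ ≤_) (sym ∣T∣≡D) (bound v≢w))

        module _ {a w y i₁} (a∈S : a ∈ˡ S) (a≡w : class a ≡ class w) (i₁∈T : i₁ ∈ T)
          (y-fresh : Fresh S y) (u≁w : ∀ {i} → i ∈ T → ¬ u ∼[ i ] w)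
          (u≁y : ¬ u ∼[ i₁ ] y) (w≁y : ¬ w ∼[ i₁ ] y) where

          y≁w : i ∈ T → ¬ y ∼[ i ] w
          y≁w {i} i∈T y∼w with i₁ ≟ i
          ... | yes refl = w≁y (∼.sym y∼w)
          -- Being fresh and different from `u` in `i₁`, `y` agrees with `u` in every other colour
          -- of `T`.
          ... | no i₁≢i  = u≁w i∈T (∼.trans
            (separates-one maximal u∈S y-fresh (T⊆A i₁∈T) (T⊆A i∈T) i₁≢i u≁y) y∼w)

          y∼w : i ∉ T → y ∼[ i ] w
          y∼w = agree-off (λ y≡w → All.lookup y-fresh a∈S (trans a≡w (sym y≡w))) y≁w

          -- On `T` the vertex `v` agrees with `u`, so it differs from `w` there; hence off `T` both
          -- `v` and `y` agree with `w`.
          others∼y : v ∈ˡ S → class v ≢ class w → i ∉ T → v ∼[ i ] y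
          others∼y v∈S v≢w i∉T = ∼.trans
            (agree-off v≢w
              (λ j∈T v∼w → u≁w j∈T (∼.trans (agree⁻ (T⊆A j∈T) u∈S v∈S) v∼w)) i∉T)
            (∼.sym (y∼w i∉T))

          -- If `a` agreed with `y` in colour `i`, so would all of `S`, because `a` is its only
          -- vertex in the class of `w`; then `i` would not separate `S`.
          a≁y : i ∉ agree S → ¬ a ∼[ i ] y
          a≁y {i} i∉A a∼y = i∉A (agree-from all∼y)
            where
            all∼y : v ∈ˡ S → v ∼[ i ] y
            all∼y {v} v∈S with class v ≟ class w
            ... | no v≢w = others∼y v∈S v≢w (i∉A ∘ T⊆A)
            ... | yes v≡w with pt a∈S v∈S (trans a≡w (sym v≡w))
            ...   | refl = a∼y

          same-class-impossible : Empty
          -- `a` and `y` differ in the at least `D` colours outside `agree S`, and also in `i₁`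
          -- inside it.
          same-class-impossible = ℕ.<⇒≱
            (ℕ.≤-<-trans D≤∣∁A∣ (p⊂q⇒∣p∣<∣q∣ {q = different a y}
              ( (λ i∈∁A → ∈-comprehension⁺ (different? a y) (a≁y (x∈∁p⇒x∉p i∈∁A)))
              , i₁
              , ∈-comprehension⁺ (different? a y)
                  (u≁y ∘ ∼.trans (agree⁻ (T⊆A i₁∈T) u∈S a∈S))
              , λ i₁∈∁A → x∈∁p⇒x∉p i₁∈∁A (T⊆A i₁∈T) )))
            (bound (All.lookup y-fresh a∈S))

      maximal-impossible : Empty
      maximal-impossible with subset-of-size D D≤∣A∣
      ... | T , T⊆A , ∣T∣≡D
        with uncovered (subst (_≤ suc t) (sym ∣T∣≡D) D≤1+t) (Vec.map (_, u) (elements T))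
      ...   | w , uncov with element {p = T} (subst (1 ≤_) (sym ∣T∣≡D) (ℕ.≤-trans (s≤s z≤n) 2≤D))
      ...     | i₁ , i₁∈T with Any.any? (λ a → class a ≟ class w) S
      ...       | no w-fresh =
        -- A fresh `w` would differ from `u` in two colours of `agree S`, which `maximal` forbids.
        let i₂ , i₂∈T , i₁≢i₂ = another i₁ (subst (2 ≤_) (sym ∣T∣≡D) 2≤D) in
        u≁w i₂∈T (separates-one maximal u∈S
          (All.tabulate λ v∈S v≡w → w-fresh (Any.map (λ { refl → v≡w }) v∈S))
          (T⊆A i₁∈T) (T⊆A i₂∈T) i₁≢i₂ (u≁w i₁∈T))
        where
        u≁w : i ∈ T → ¬ u ∼[ i ] w
        u≁w i∈T = uncov (∈-map⁺ (_, u) (∈-elements i∈T))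
      -- Otherwise `y` is taken from a class missed by `S`, outside the components of `u` and `w` in
      -- colour `i₁`.
      ...       | yes a-hit with find a-hit | missing-class {S} ∣S∣<r
      ...         | a , a∈S , a≡w | c , c-fresh with avoid i₁ u w c
      ...           | y , refl , u≁y , w≁y =
        same-class-impossible T⊆A ∣T∣≡D a∈S a≡w i₁∈T c-fresh
          (λ i∈T → uncov (∈-map⁺ (_, u) (∈-elements i∈T))) u≁y w≁y

    -- m counts the vertices added to the initial pair.
    grow : ∀ fuel m {u S} → u ∈ˡ S → PartialTransversal S → length S ≡ 2 + m →
           ∣ agree S ∣ ≤ fuel → ∣ agree S ∣ + (D + (m + m)) ≤ k → Empty
    grow fuel m {u} {S} u∈S pt ∣S∣≡2+m ∣A∣≤fuel room with any? (extension? S)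
    ... | no maximal = maximal-impossible u∈S pt maximal D≤1+t ∣S∣<r D≤∣A∣
            (subst (D ≤_) (sym (∣∁p∣≡n∸∣p∣ (agree S))) (ℕ.m+n≤o⇒m≤o∸n D D+∣A∣≤k))
      where
      open ≤-Reasoning
      A = ∣ agree S ∣
      r≤ : r ≤ A + suc m
      r≤ = s≤s⁻¹ (begin-strict
        r              <⟨ r≮agree u∈S pt ⟩
        A + length S   ≡⟨ cong (A +_) ∣S∣≡2+m ⟩
        A + (2 + m)    ≡⟨ ℕ.+-suc A (suc m) ⟩
        suc (A + suc m) ∎)
      -- Adding `D + m` to both sides of `r≤` makes its right side one more than the left side of
      -- `room`, hence at most `1 + k`.
      D+m≤1+t : D + m ≤ suc t
      D+m≤1+t = ℕ.+-cancelˡ-≤ r _ _ (begin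
        r + (D + m)              ≤⟨ ℕ.+-monoˡ-≤ (D + m) r≤ ⟩
        A + suc m + (D + m)      ≡⟨ rearrange A D m ⟩
        suc (A + (D + (m + m)))  ≤⟨ s≤s (ℕ.≤-trans room k≤r+t) ⟩
        suc (r + t)              ≡⟨ ℕ.+-suc r t ⟨
        r + suc t                ∎)
        where
        rearrange : ∀ A D m → A + suc m + (D + m) ≡ suc (A + (D + (m + m)))
        rearrange = solve-∀
      D≤1+t : D ≤ suc t
      D≤1+t = ℕ.m+n≤o⇒m≤o D D+m≤1+t
      D≤∣A∣ : D ≤ A
      D≤∣A∣ = ℕ.+-cancelʳ-≤ (suc m) _ _ (begin
        D + suc m    ≡⟨ ℕ.+-suc D m ⟩
        suc (D + m)  ≤⟨ s≤s D+m≤1+t ⟩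
        2 + t        ≤⟨ t+2≤r ⟩
        r            ≤⟨ r≤ ⟩
        A + suc m    ∎)
      ∣S∣<r : length S < r
      ∣S∣<r = begin-strict
        length S  ≡⟨ ∣S∣≡2+m ⟩
        2 + m     ≤⟨ ℕ.+-monoˡ-≤ m 2≤D ⟩
        D + m     ≤⟨ D+m≤1+t ⟩
        suc t     <⟨ t+2≤r ⟩
        r         ∎
      D+∣A∣≤k : D + A ≤ k
      D+∣A∣≤k = begin
        D + A              ≡⟨ ℕ.+-comm D A ⟩
        A + D              ≤⟨ ℕ.+-monoʳ-≤ A (ℕ.m≤m+n D (m + m)) ⟩
        A + (D + (m + m))  ≤⟨ room ⟩
        k                  ∎
    grow zero m _ _ _ ∣A∣≤0 _ | yes (_ , _ , 2+≤) =
      contradiction (ℕ.≤-trans 2+≤ ∣A∣≤0) λ ()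
    grow (suc fuel) m {S = S} u∈S pt ∣S∣≡2+m ∣A∣≤ room | yes (w , fr , 2+≤) =
      grow fuel (suc m) (there u∈S) (extend pt fr) (cong suc ∣S∣≡2+m)
        (s≤s⁻¹ (ℕ.≤-trans (ℕ.n≤1+n _) (ℕ.≤-trans 2+≤ ∣A∣≤)))
        -- The two units added by `suc m` are paid for by the colours that `w` removes from
        -- `agree S`.
        (begin
          A′ + (D + (suc m + suc m))  ≡⟨ rearrange A′ D m ⟩
          2 + A′ + (D + (m + m))      ≤⟨ ℕ.+-monoˡ-≤ (D + (m + m)) 2+≤ ⟩
          ∣ agree S ∣ + (D + (m + m)) ≤⟨ room ⟩
          k                           ∎)
      where
      open ≤-Reasoning
      A′ = ∣ agree (w ∷ S) ∣
      rearrange : ∀ A D m → A + (D + (suc m + suc m)) ≡ 2 + A + (D + (m + m))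
      rearrange = solve-∀

    -- Such a pair starts `grow`: the `D` colours in which it differs lie outside `agree pair`, so
    -- the counting hypothesis holds with `m = 0`.
    distance≢ : class u ≢ class v → ∣ different u v ∣ ≢ D
    distance≢ {u} {v} u≢v eq = grow _ 0 (here refl)
      (extend (extend {S = []} (λ ()) []) ((u≢v ∘ sym) ∷ [])) refl ℕ.≤-refl
      (begin
        A + (D + 0)                  ≡⟨ cong (A +_) (trans (ℕ.+-identityʳ D) (sym eq)) ⟩
        A + ∣ different u v ∣        ≤⟨ ℕ.+-monoʳ-≤ A (p⊆q⇒∣p∣≤∣q∣ different⊆∁A) ⟩
        A + ∣ ∁ (agree pair) ∣          ≡⟨ cong (A +_) (∣∁p∣≡n∸∣p∣ (agree pair)) ⟩
        A + (k ∸ A)                  ≡⟨ ℕ.m+[n∸m]≡n (∣p∣≤n (agree pair)) ⟩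
        k                            ∎)
      where
      open ≤-Reasoning
      pair = u ∷ v ∷ []
      A = ∣ agree pair ∣
      different⊆∁A : different u v ⊆ ∁ (agree pair)
      different⊆∁A i∈ = x∉p⇒x∈∁p λ i∈A → ∈-comprehension⁻ (different? u v) i∈
        (agree⁻ i∈A (here refl) (there (here refl)))

  -- Take three classes, with `v₁`, `v₂` differing in `i` and `v₂`, `v₃` in `j`. If distances are at
  -- most one, `v₂` and `v₃` agree in `i`, so `v₁` and `v₃` differ in `i`; then `v₁` agrees with
  -- both others in `j`, a contradiction.
  distance≥2 : ¬ DistanceBound 1
  distance≥2 bound
    with missing-class {[]} (ℕ.≤-trans (s≤s z≤n) t+2≤r)
  ... | c₁ , _ with nonempty c₁
  ...   | v₁ , _ with ∣agree∣≥2
    where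
    ∣agree∣≥2 : 2 ≤ ∣ agree (v₁ ∷ []) ∣
    ∣agree∣≥2 = ℕ.+-cancelʳ-≤ 1 _ _ (ℕ.≤-trans
      (s≤s (ℕ.≤-trans (s≤s 1≤t) (ℕ.≤-trans (ℕ.n≤1+n _) t+2≤r)))
      (r≮agree {S = v₁ ∷ []} (here refl) (extend {S = []} (λ ()) [])))
  ...     | 2≤ with element {p = agree (v₁ ∷ [])} (ℕ.≤-trans (s≤s z≤n) 2≤)
  ...       | i , _ with another {p = agree (v₁ ∷ [])} i 2≤
  ...         | j , _ , i≢j with missing-class {v₁ ∷ []} (ℕ.≤-trans (s≤s (s≤s z≤n)) t+2≤r)
  ...           | c₂ , v₁≢v₂ ∷ [] with avoid i v₁ v₁ c₂
  ...             | v₂ , refl , v₁≁v₂ , _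
    with missing-class {v₂ ∷ v₁ ∷ []} (ℕ.≤-trans (s≤s (s≤s 1≤t)) t+2≤r)
  ...               | c₃ , v₂≢v₃ ∷ v₁≢v₃ ∷ [] with avoid j v₂ v₂ c₃
  ...                 | v₃ , refl , v₂≁v₃ , _ =
    v₂≁v₃ (∼.trans (∼.sym (one v₁≢v₂ i≢j v₁≁v₂))
      (one v₁≢v₃ i≢j λ v₁∼v₃ → v₁≁v₂ (∼.trans v₁∼v₃ (∼.sym (one v₂≢v₃ (i≢j ∘ sym) v₂≁v₃)))))
    where
    one : ∀ {i j} → class u ≢ class v → i ≢ j → ¬ u ∼[ i ] v → u ∼[ j ] v
    one {u} {v} u≢v i≢j u≁v = stable λ u≁v′ → ℕ.<⇒≱
      (two≤ (∈-comprehension⁺ (different? u v) u≁v) (∈-comprehension⁺ (different? u v) u≁v′) i≢j)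
      (bound u≢v)

  -- Descent takes the place of choosing a largest distance: for `D ≥ 2` no pair has distance
  -- exactly `D`, so the bound drops by one.
  no-distance-bound : ∀ D → ¬ DistanceBound D
  no-distance-bound 0 bound = distance≥2 λ u≢v → ℕ.≤-trans (bound u≢v) z≤n
  no-distance-bound 1 = distance≥2
  no-distance-bound (suc (suc d)) bound = no-distance-bound (suc d) λ u≢v →
    s≤s⁻¹ (ℕ.≤∧≢⇒< (bound u≢v) (distance≢ (s≤s (s≤s z≤n)) bound u≢v))

  uncovered-impossible : Empty
  uncovered-impossible = no-distance-bound k λ {u} {v} _ → ∣p∣≤n (different u v)

-- Linkedness as an equivalence relation.

module _ (H : Hypergraph) where
  open Hypergraph H

  private
    variable
      e f g h : Subset order

  chain-++ : Chain H e f → Nonempty (f ∩ g) → Chain H g h → Chain H e h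
  chain-++ [ p ]          x d = p ∷⟨ x ⟩ d
  chain-++ (p ∷⟨ y ⟩ c) x d = p ∷⟨ y ⟩ chain-++ c x d

  chain-reverse : Chain H e f → Chain H f e
  chain-reverse [ p ] = [ p ]
  chain-reverse (p ∷⟨ x , x∈ ⟩ c) =
    chain-++ (chain-reverse c) (x , x∈p∩q⁺ (swap (x∈p∩q⁻ _ _ x∈))) [ p ]

  linked-isEquivalence : IsEquivalence (Linked H)
  linked-isEquivalence = record { refl = inj₁ refl ; sym = linked-sym ; trans = linked-trans }
    where
    linked-sym : ∀ {u v} → Linked H u v → Linked H v u
    linked-sym (inj₁ refl)                    = inj₁ refl
    linked-sym (inj₂ (_ , _ , u∈ , v∈ , c)) = inj₂ (_ , _ , v∈ , u∈ , chain-reverse c)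
    linked-trans : ∀ {u v w} → Linked H u v → Linked H v w → Linked H u w
    linked-trans (inj₁ refl) l = l
    linked-trans l (inj₁ refl) = l
    linked-trans (inj₂ (_ , _ , u∈ , v∈ , c)) (inj₂ (_ , _ , v∈′ , w∈ , d)) =
      inj₂ (_ , _ , u∈ , w∈ , chain-++ c (_ , x∈p∩q⁺ (v∈ , v∈′)) d)

  linked-isDecEquivalence : IsDecEquivalence (Linked H)
  linked-isDecEquivalence = record { isEquivalence = linked-isEquivalence ; _≟_ = linked? H }

  edge⇒linked : ∀ {u v} → Edge e → u ∈ e → v ∈ e → Linked H u v
  edge⇒linked p u∈e v∈e = inj₂ (_ , _ , u∈e , v∈e , [ p ])

transversal-of : ∀ {r} (V : Partition r) (let open Partition V) (f : Fin r → Fin order) →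
                 (∀ i → class (f i) ≡ i) → ∃[ e ] (Transversal V e × ∀ i → f i ∈ e)
transversal-of V f f-class = comprehension chosen?
  , (λ i → f i , (f∈ i , f-class i)
         , λ (w∈ , w≡i) → trans (cong f (sym w≡i)) (sym (∈-comprehension⁻ chosen? w∈)))
  , f∈
  where
  open Partition V
  chosen? : Decidable (λ v → v ≡ f (class v))
  chosen? v = v ≟ f (class v)
  f∈ : ∀ i → f i ∈ comprehension chosen?
  f∈ i = ∈-comprehension⁺ chosen? (cong f (sym (f-class i)))

-- Colour classes of a spanning colouring.

module _ {r k : ℕ} (V : Partition r) (χ : Coloring (complete V) k)
  (spanning : Spanning (complete V) χ) where
  open Partition V

  private
    K = complete V

  -- Colours that are not used are replaced by a used one: only then do all
  -- monochromatic components meet every class.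
  representative : ∀ i → ∃[ j ] (Used K χ j × (Used K χ i → j ≡ i))
  representative i with anySubset? (Hypergraph.edge? (colorClass K χ i))
  ... | yes used = i , used , λ _ → refl
  ... | no unused = let e , p = complete-edge V in
    χ e p , (e , p , refl) , λ used → contradiction used unused

  layer : Fin k → Hypergraph
  layer i = colorClass K χ (proj₁ (representative i))

  layer-meets : ∀ i v c → ∃[ u ] (class u ≡ c × Linked (layer i) v u)
  layer-meets i v c with spanning _ (proj₁ (proj₂ (representative i))) v
  ... | e , p , v∈e with proj₁ p c
  ...   | u , (u∈e , u∈c) , _ = u , u∈c , edge⇒linked (layer i) p v∈e u∈e

  layer-monochromatic : (f : Fin r → Fin order) → (∀ c → class (f c) ≡ c) →
                        ∃[ i ] ∀ c c′ → Linked (layer i) (f c) (f c′)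
  layer-monochromatic f f-class with transversal-of V f f-class
  -- The colour of `e` is used, by `e` itself, so `representative` leaves it unchanged.
  ... | e , p , f∈e = χ e p , λ c c′ → edge⇒linked (layer (χ e p))
    (p , sym (proj₂ (proj₂ (representative (χ e p))) (e , p , refl))) (f∈e c) (f∈e c′)

  layer-uncovered : ∀ {m} → ¬ CoverableBy K χ m → (ps : Vec (Fin k × Fin order) m) →
                    ∃[ w ] ∀ {i v} → (i , v) ∈ᵛ ps → ¬ Linked (layer i) v w
  layer-uncovered {m} ¬cover ps = w , λ {i} {v} iv∈ v∼w → w-missed (VAny.map⁺ (VAny.map
      (λ { refl → Equivalence.from (proj₂ (component-isComponent (layer i) v) w) v∼w }) iv∈))
    where
    parts : Vec (Subset order) m
    parts = Vec.map (λ (i , v) → component (layer i) v) ps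
    missed : ∃[ w ] ¬ VAny.Any (w ∈_) parts
    missed = ¬∀⟶∃¬ order _ (λ v → VAny.any? (v ∈?_) parts) λ cover → ¬cover
      ( parts
      , VAll.map⁺ (VAll.universal (λ (i , v) → _ , component-isComponent (layer i) v) ps)
      , cover )
    w = proj₁ missed
    w-missed = proj₂ missed

theorem2p5 : (r t : ℕ) → 3 ≤ r → 1 ≤ t → t ≤ r ∸ 2 → cov[ r , r + t ]≤ (t + 1)
theorem2p5 r t 3≤r 1≤t t≤r∸2 _ (V , χ , spanning , refl) =
  decidable-stable (c V χ ℕ.≤? t + 1) λ c≰t+1 →
    uncovered-impossible V (λ u i v → Linked (layer V χ spanning i) u v)
      (λ i → linked-isDecEquivalence (layer V χ spanning i))
      1≤t 2+t≤r ℕ.≤-refl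
      (layer-meets V χ spanning) (layer-monochromatic V χ spanning)
      -- A cover by `m ≤ t + 1` components would bound the minimum `c V χ` by `t + 1`.
      λ {m} m≤1+t → layer-uncovered V χ spanning λ cover → c≰t+1
        (ℕ.≤-trans (proj₂ (c-isCoverNumber V χ) _ cover) (subst (m ≤_) (ℕ.+-comm 1 t) m≤1+t))
  where
  2+t≤r : 2 + t ≤ r
  -- `r ∸ 2` is not truncated, since `3 ≤ r`.
  2+t≤r = subst (_≤ r) (ℕ.+-comm t 2) (ℕ.m≤o∸n⇒m+n≤o t (ℕ.≤-trans (ℕ.n≤1+n 2) 3≤r) t≤r∸2)
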